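{- The logic $\mathcal{RDMH}$ is BP-algebraizable (algebraizable in the sense of Blok and Pigozzi) with the variety $\mathbb{RDMH}$ of regular De Morgan Heyting algebras as its equivalent algebraic semantics.
   Context: Variety. $\mathbb{RDMH}$ consists of the algebras $\langle A,\vee,\wedge,\to,{}',0,1\rangle$ such that $\langle A,\vee,\wedge,\to,0,1\rangle$ is a Heyting algebra, $\langle A,\vee,\wedge,{}',0,1\rangle$ is a De Morgan algebra ($x''\approx x$, $(x\vee y)'\approx x'\wedge y'$, $(x\wedge y)'\approx x'\vee y'$, $0'\approx1$, $1'\approx0$), and, with $x^*:=x\to0$, $(x\wedge ((x')^*)')\vee(y\vee y^*)\approx y\vee y^*$ holds. The language $\langle\vee,\wedge,\to,\sim,\bot,\top\rangle$ is interpreted with $\sim$ as ${}'$, $\bot$ as $0$, $\top$ as $1$. Logics. Formulas are built from a countably infinite set of propositional variables in the language $\langle \vee,\wedge,\to,\sim,\bot,\top\rangle$. Abbreviations: $\alpha\to_H\beta:=\alpha\to(\alpha\wedge\beta)$; $\alpha\leftrightarrow_H\beta:=(\alpha\to_H\beta)\wedge(\beta\to_H\alpha)$; $\beta^*:=\beta\to\bot$. A Hilbert-style logic is the consequence relation $\Gamma\vdash\varphi$ given by finite derivations using elements of $\Gamma$, substitution instances of axioms, and instances of the rules. The logic $\mathcal{DHMSH}$ has axioms: (1) $\alpha\to_H(\alpha\vee\beta)$; (2) $\beta\to_H(\alpha\vee\beta)$; (3) $(\alpha\to_H\gamma)\to_H[(\beta\to_H\gamma)\to_H\{(\alpha\vee\beta)\to_H\gamma\}]$;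 (4) $(\alpha\wedge\beta)\to_H\alpha$; (5) $(\gamma\to_H\alpha)\to_H[(\gamma\to_H\beta)\to_H(\gamma\to_H(\alpha\wedge\beta))]$; (6) $\top$; (7) $\bot\to_H\alpha$; (8) $[(\alpha\wedge\beta)\to_H\gamma]\to_H[\alpha\to_H(\beta\to_H\gamma)]$; (9) $[\alpha\to_H(\beta\to_H\gamma)]\to_H[(\alpha\wedge\beta)\to_H\gamma]$; (10) $(\alpha\to_H\beta)\to_H[(\beta\to_H\alpha)\to_H((\alpha\to\gamma)\to_H(\beta\to\gamma))]$; (11) $(\alpha\to_H\beta)\to_H[(\beta\to_H\alpha)\to_H((\gamma\to\beta)\to_H(\gamma\to\alpha))]$; (12) $\top\to_H\sim\bot$; (13) $\sim\top\to_H\bot$; (14) $\sim(\alpha\wedge\beta)\to_H(\sim\alpha\vee\sim\beta)$; and rules (MP): from $\varphi$ and $\varphi\to_H\gamma$ deduce $\gamma$; (CP): from $\varphi\to_H\gamma$ deduce $\sim\gamma\to_H\sim\varphi$. The logic $\mathcal{RDMH}$ is the axiomatic extension of $\mathcal{DHMSH}$ (same rules) by: (15) $(\alpha\wedge\beta)\to\alpha$; (20) $\sim\sim\alpha\leftrightarrow_H\alpha$; ($\mathcal M_2$) $[\{\alpha\wedge\sim((\sim\alpha)^*)\}\vee(\beta\vee\beta^*)]\leftrightarrow_H(\beta\vee\beta^*)$. Algebraizability. For a class $\mathbb K$ of algebras, $\Delta\models_{\mathbb K}\alpha\approx\beta$ means: in every $\mathbf A\in\mathbb K$, every valuation satisfying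 all identities in $\Delta$ satisfies $\alpha\approx\beta$. A class $\mathbb K$ is an equivalent algebraic semantics of a logic $\vdash$ if there are finitely many identities $\delta_i(p)\approx\epsilon_i(p)$ in one variable and finitely many formulas $\Delta_j(p,q)$ such that: (A) for all $\Gamma\cup\{\varphi\}$, $\Gamma\vdash\varphi$ iff $\{\delta_i(\psi)\approx\epsilon_i(\psi): i,\ \psi\in\Gamma\}\models_{\mathbb K}\delta_k(\varphi)\approx\epsilon_k(\varphi)$ for all $k$; (B) for all formulas $\varphi,\psi$, $\varphi\approx\psi$ and the set $\{\delta_i(\Delta_j(\varphi,\psi))\approx\epsilon_i(\Delta_j(\varphi,\psi)):i,j\}$ are $\models_{\mathbb K}$-consequences of each other. A logic is BP-algebraizable if it has an equivalent algebraic semantics. -}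

module Defs where

open import Level using (Level; _⊔_; 0ℓ) renaming (suc to lsuc)
open import Algebra.Core using (Op₁; Op₂)
open import Algebra.Definitions using (Congruent₁; Congruent₂; Identity)
open import Algebra.Lattice.Structures using (IsDistributiveLattice)
open import Data.Fin.Base using (Fin)
open import Data.List.Base using (List)
open import Data.List.Membership.Propositional using () renaming (_∈_ to _∈ˡ_)
open import Data.Nat.Base using (ℕ)
open import Data.Product.Base using (Σ; ∃; ∃₂; _×_)
open import Data.Vec.Base using (Vec; []; _∷_; lookup)
open import Function.Bundles using (_⇔_)
open import Relation.Binary.Construct.NaturalOrder.Left using (_≤_)
open import Relation.Binary.Core using (Rel)
open import Relation.Binary.Lattice.Structures using (IsHeytingAlgebra)
open import Relation.Binary.PropositionalEquality.Core using (_≡_)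
open import Relation.Binary.Structures using (IsEquivalence)
open import Relation.Unary using (Pred; _∈_; ｛_｝)

infix  8 `∼_
infixr 7 _`∧_
infixr 6 _`∨_
infixr 5 _`→_

data Term (V : Set) : Set where
  var            : V → Term V
  _`∨_ _`∧_ _`→_ : Term V → Term V → Term V
  `∼_            : Term V → Term V
  `⊥ `⊤          : Term V

Formula : Set
Formula = Term ℕ

module _ {V : Set} where

  infix  9 _`*
  infixr 5 _→ᴴ_
  infix  5 _↔ᴴ_

  _→ᴴ_ _↔ᴴ_ : Term V → Term V → Term V
  α →ᴴ β = α `→ (α `∧ β)
  α ↔ᴴ β = (α →ᴴ β) `∧ (β →ᴴ α)

  _`* : Term V → Term V
  β `* = β `→ `⊥

subst : {V W : Set} → (V → Term W) → Term V → Term W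
subst σ (var v)  = σ v
subst σ (s `∨ t) = subst σ s `∨ subst σ t
subst σ (s `∧ t) = subst σ s `∧ subst σ t
subst σ (s `→ t) = subst σ s `→ subst σ t
subst σ (`∼ t)   = `∼ subst σ t
subst σ `⊥       = `⊥
subst σ `⊤       = `⊤

-- A term in n variables, evaluated at n formulas.
_⟦_⟧ : {n : ℕ} → Term (Fin n) → Vec Formula n → Formula
t ⟦ φs ⟧ = subst (lookup φs) t

record Equation (V : Set) : Set where
  constructor _`≈_
  field
    lhs rhs : Term V

infix 4 _`≈_

_⟦_⟧ᵉ : {n : ℕ} → Equation (Fin n) → Vec Formula n → Equation ℕ
(s `≈ t) ⟦ φs ⟧ᵉ = (s ⟦ φs ⟧) `≈ (t ⟦ φs ⟧)

-- Algebras in the language ⟨∨,∧,→,∼,⊥,⊤⟩.  As usual in the library, the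
-- equality of an algebra is an equivalence relation _≈_ that all the
-- operations respect; quotients only change this relation.
record Algebra (c ℓ : Level) : Set (lsuc (c ⊔ ℓ)) where
  infix  8 _′
  infixr 7 _∧_
  infixr 6 _∨_
  infixr 5 _⇒_
  infix  4 _≈_
  field
    Carrier       : Set c
    _≈_           : Rel Carrier ℓ
    _∨_ _∧_ _⇒_   : Op₂ Carrier
    _′            : Op₁ Carrier
    0# 1#         : Carrier
    isEquivalence : IsEquivalence _≈_
    ∨-cong        : Congruent₂ _≈_ _∨_
    ∧-cong        : Congruent₂ _≈_ _∧_
    ⇒-cong        : Congruent₂ _≈_ _⇒_
    ′-cong        : Congruent₁ _≈_ _′

  infix 9 _*
  _* : Op₁ Carrier
  x * = x ⇒ 0#

  eval : {V : Set} → (V → Carrier) → Term V → Carrier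
  eval v (var x)  = v x
  eval v (s `∨ t) = eval v s ∨ eval v t
  eval v (s `∧ t) = eval v s ∧ eval v t
  eval v (s `→ t) = eval v s ⇒ eval v t
  eval v (`∼ t)   = (eval v t) ′
  eval v `⊥       = 0#
  eval v `⊤       = 1#

  Satisfies : {V : Set} → (V → Carrier) → Equation V → Set ℓ
  Satisfies v (s `≈ t) = eval v s ≈ eval v t

module _ {c ℓ : Level} (A : Algebra c ℓ) where
  open Algebra A

  record IsDeMorgan : Set (c ⊔ ℓ) where
    field
      isDistributiveLattice : IsDistributiveLattice _≈_ _∨_ _∧_
      ∨-identity            : Identity _≈_ 0# _∨_
      ∧-identity            : Identity _≈_ 1# _∧_
      ′-involutive          : ∀ x → x ′ ′ ≈ x
      ∨-deMorgan            : ∀ x y → (x ∨ y) ′ ≈ x ′ ∧ y ′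
      ∧-deMorgan            : ∀ x y → (x ∧ y) ′ ≈ x ′ ∨ y ′
      0′≈1                  : 0# ′ ≈ 1#
      1′≈0                  : 1# ′ ≈ 0#

  record IsRDMH : Set (c ⊔ ℓ) where
    field
      -- The order is the lattice order: x ≤ y means x ≈ x ∧ y.
      isHeyting  : IsHeytingAlgebra _≈_ (_≤_ _≈_ _∧_) _∨_ _∧_ _⇒_ 1# 0#
      isDeMorgan : IsDeMorgan
      regular    : ∀ x y → (x ∧ ((x ′) *) ′) ∨ (y ∨ y *) ≈ y ∨ y *

-- Axioms are given as schemes, so that the set of axioms already contains all
-- the substitution instances.
data DHMSH-Axiom : Formula → Set where
  ax1  : ∀ α β   → DHMSH-Axiom (α →ᴴ (α `∨ β))
  ax2  : ∀ α β   → DHMSH-Axiom (β →ᴴ (α `∨ β))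
  ax3  : ∀ α β γ → DHMSH-Axiom ((α →ᴴ γ) →ᴴ ((β →ᴴ γ) →ᴴ ((α `∨ β) →ᴴ γ)))
  ax4  : ∀ α β   → DHMSH-Axiom ((α `∧ β) →ᴴ α)
  ax5  : ∀ α β γ → DHMSH-Axiom ((γ →ᴴ α) →ᴴ ((γ →ᴴ β) →ᴴ (γ →ᴴ (α `∧ β))))
  ax6  :           DHMSH-Axiom `⊤
  ax7  : ∀ α     → DHMSH-Axiom (`⊥ →ᴴ α)
  ax8  : ∀ α β γ → DHMSH-Axiom (((α `∧ β) →ᴴ γ) →ᴴ (α →ᴴ (β →ᴴ γ)))
  ax9  : ∀ α β γ → DHMSH-Axiom ((α →ᴴ (β →ᴴ γ)) →ᴴ ((α `∧ β) →ᴴ γ))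
  ax10 : ∀ α β γ →
         DHMSH-Axiom ((α →ᴴ β) →ᴴ ((β →ᴴ α) →ᴴ ((α `→ γ) →ᴴ (β `→ γ))))
  ax11 : ∀ α β γ →
         DHMSH-Axiom ((α →ᴴ β) →ᴴ ((β →ᴴ α) →ᴴ ((γ `→ β) →ᴴ (γ `→ α))))
  ax12 :           DHMSH-Axiom (`⊤ →ᴴ (`∼ `⊥))
  ax13 :           DHMSH-Axiom ((`∼ `⊤) →ᴴ `⊥)
  ax14 : ∀ α β   → DHMSH-Axiom ((`∼ (α `∧ β)) →ᴴ ((`∼ α) `∨ (`∼ β)))

data RDMH-Axiom : Formula → Set where
  dhmsh : ∀ {φ} → DHMSH-Axiom φ → RDMH-Axiom φ
  -- The main connective of ax15 is the primitive implication, not →ᴴ.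
  ax15  : ∀ α β → RDMH-Axiom ((α `∧ β) `→ α)
  ax20  : ∀ α   → RDMH-Axiom ((`∼ (`∼ α)) ↔ᴴ α)
  axM₂  : ∀ α β → RDMH-Axiom
          (((α `∧ (`∼ ((`∼ α) `*))) `∨ (β `∨ (β `*))) ↔ᴴ (β `∨ (β `*)))

Logic : (ℓ : Level) → Set (lsuc ℓ)
Logic ℓ = Pred Formula ℓ → Formula → Set ℓ

data Derivable {ℓ : Level} (Ax : Pred Formula 0ℓ) (Γ : Pred Formula ℓ) :
               Formula → Set ℓ where
  hyp : ∀ {φ}   → φ ∈ Γ → Derivable Ax Γ φ
  ax  : ∀ {φ}   → φ ∈ Ax → Derivable Ax Γ φ
  mp  : ∀ {φ γ} → Derivable Ax Γ φ → Derivable Ax Γ (φ →ᴴ γ) → Derivable Ax Γ γ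
  cp  : ∀ {φ γ} → Derivable Ax Γ (φ →ᴴ γ) → Derivable Ax Γ ((`∼ γ) →ᴴ (`∼ φ))

RDMH-logic : (ℓ : Level) → Logic ℓ
RDMH-logic ℓ Γ φ = Derivable RDMH-Axiom Γ φ

AlgebraClass : (c ℓ : Level) → Set (lsuc (c ⊔ ℓ))
AlgebraClass c ℓ = Pred (Algebra c ℓ) (c ⊔ ℓ)

RDMH-variety : (c ℓ : Level) → AlgebraClass c ℓ
RDMH-variety c ℓ A = IsRDMH A

Consequence : {c ℓ p : Level} → AlgebraClass c ℓ →
              Pred (Equation ℕ) p → Equation ℕ → Set (lsuc (c ⊔ ℓ) ⊔ p)
Consequence {c} {ℓ} K Δ e =
  (A : Algebra c ℓ) → A ∈ K → (v : ℕ → Algebra.Carrier A) →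
  (∀ d → d ∈ Δ → Algebra.Satisfies A v d) → Algebra.Satisfies A v e

syntax Consequence K Δ e = Δ ⊨[ K ] e

module _ (δε : List (Equation (Fin 1))) where

  -- The set { δᵢ(ψ) ≈ εᵢ(ψ) : i, ψ ∈ Γ }.
  translation : {p : Level} → Pred Formula p → Pred (Equation ℕ) p
  translation Γ e = ∃₂ λ d ψ → d ∈ˡ δε × ψ ∈ Γ × e ≡ d ⟦ ψ ∷ [] ⟧ᵉ

  -- The set { δᵢ(Δⱼ(φ,ψ)) ≈ εᵢ(Δⱼ(φ,ψ)) : i, j }.
  equivalence : List (Term (Fin 2)) → Formula → Formula → Pred (Equation ℕ) 0ℓ
  equivalence Δ φ ψ = translation (λ χ → ∃ λ t → t ∈ˡ Δ × χ ≡ t ⟦ φ ∷ ψ ∷ [] ⟧)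

record IsEquivalentAlgebraicSemantics
         {c ℓ : Level} (K : AlgebraClass c ℓ) (_⊢_ : Logic ℓ) :
         Set (lsuc (c ⊔ ℓ)) where
  field
    definingEquations   : List (Equation (Fin 1))
    equivalenceFormulas : List (Term (Fin 2))

    conditionA : ∀ Γ φ →
      (Γ ⊢ φ) ⇔
      (∀ d → d ∈ˡ definingEquations →
         translation definingEquations Γ ⊨[ K ] (d ⟦ φ ∷ [] ⟧ᵉ))

    conditionB-to : ∀ φ ψ e →
      e ∈ equivalence definingEquations equivalenceFormulas φ ψ →
      ｛ φ `≈ ψ ｝ ⊨[ K ] e

    conditionB-from : ∀ φ ψ →
      equivalence definingEquations equivalenceFormulas φ ψ ⊨[ K ] (φ `≈ ψ)

BPAlgebraizable : (c : Level) {ℓ : Level} → Logic ℓ → Set (lsuc (c ⊔ ℓ))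
BPAlgebraizable c {ℓ} L =
  Σ (AlgebraClass c ℓ) λ K → IsEquivalentAlgebraicSemantics K L

{-# OPTIONS --safe #-}

-- Read α ⊑ β as Γ ⊢ α →ᴴ β.  Axioms (4), (5), (8) and (9) make →ᴴ residuated
-- with respect to ∧, but transitivity of ⊑ is only reached through the
-- replacement axioms (10) and (11) for the primitive →.  Axiom (15) then makes
-- α → β interderivable with α →ᴴ β, so the Lindenbaum–Tarski algebra of Γ is a
-- Heyting algebra, and, by (CP), (14), (20) and (M₂), a member of the variety.
-- Hence p ≈ ⊤ and p ↔ᴴ q witness algebraizability.

module Submission where

open import Data.Fin.Base using (zero; suc)
open import Data.List.Base using ([]; _∷_)
open import Data.List.Relation.Unary.Any using (here)
open import Data.Nat.Base using (ℕ)
open import Data.Product.Base using (_×_; _,_; proj₁; proj₂)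
open import Function.Base using (_∘_)
open import Function.Bundles using (mk⇔)
open import Level using (Level; Lift; lift; lower)
open import Relation.Binary.Construct.NaturalOrder.Left using () renaming (_≤_ to NaturalOrder)
open import Relation.Binary.Lattice.Bundles using (HeytingAlgebra)
open import Relation.Binary.Lattice.Structures using (IsHeytingAlgebra)
import Relation.Binary.Lattice.Properties.BoundedJoinSemilattice as BoundedJoin
import Relation.Binary.Lattice.Properties.BoundedMeetSemilattice as BoundedMeet
import Relation.Binary.Lattice.Properties.DistributiveLattice as Distributive
import Relation.Binary.Lattice.Properties.HeytingAlgebra as Heyting
import Relation.Binary.Lattice.Properties.JoinSemilattice as Join
import Relation.Binary.Lattice.Properties.Lattice as LatticeProperties
import Relation.Binary.Lattice.Properties.MeetSemilattice as Meet
open import Relation.Binary.PropositionalEquality.Core using (_≡_; refl; cong; cong₂)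
open import Relation.Unary using (Pred; _∈_)
open import Defs

private
  variable
    a c ℓ ℓ₁ ℓ₂ : Level

-- Heyting algebras under their lattice order.

module _ (H : HeytingAlgebra a ℓ₁ ℓ₂) where
  open HeytingAlgebra H
    renaming (refl to ≤-refl; trans to ≤-trans)

  ≤⇒natural : ∀ {x y} → x ≤ y → NaturalOrder _≈_ _∧_ x y
  ≤⇒natural x≤y = antisym (∧-greatest ≤-refl x≤y) (x∧y≤x _ _)

  natural⇒≤ : ∀ {x y} → NaturalOrder _≈_ _∧_ x y → x ≤ y
  natural⇒≤ x≈x∧y = ≤-trans (reflexive x≈x∧y) (x∧y≤y _ _)

  -- `IsRDMH` requires the order `x ≈ x ∧ y`, whereas the Lindenbaum-Tarski algebra comes ordered by
  -- `⊑`. The two orders agree, so every law transfers along the two implications above.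
  naturalIsHeytingAlgebra :
    IsHeytingAlgebra _≈_ (NaturalOrder _≈_ _∧_) _∨_ _∧_ _⇨_ ⊤ ⊥
  naturalIsHeytingAlgebra = record
    { isBoundedLattice = record
      { isLattice = record
        { isPartialOrder = record
          { isPreorder = record
            { isEquivalence = isEquivalence
            ; reflexive     = ≤⇒natural ∘ reflexive
            ; trans         = λ p q → ≤⇒natural (≤-trans (natural⇒≤ p) (natural⇒≤ q))
            }
          ; antisym = λ p q → antisym (natural⇒≤ p) (natural⇒≤ q)
          }
        ; supremum = λ x y →
            ≤⇒natural (x≤x∨y x y) , ≤⇒natural (y≤x∨y x y) ,
            λ _ p q → ≤⇒natural (∨-least (natural⇒≤ p) (natural⇒≤ q))
        ; infimum = λ x y →
            ≤⇒natural (x∧y≤x x y) , ≤⇒natural (x∧y≤y x y) ,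
            λ _ p q → ≤⇒natural (∧-greatest (natural⇒≤ p) (natural⇒≤ q))
        }
      ; maximum = ≤⇒natural ∘ maximum
      ; minimum = ≤⇒natural ∘ minimum
      }
    ; exponential = λ _ _ _ →
        ≤⇒natural ∘ transpose-⇨ ∘ natural⇒≤ , ≤⇒natural ∘ transpose-∧ ∘ natural⇒≤
    }

-- Soundness in regular De Morgan Heyting algebras.

module _ {A : Algebra c ℓ} (A∈RDMH : IsRDMH A) where
  open Algebra A using (Carrier; _≈_; _∨_; _∧_; _⇒_; _′; 0#; 1#; eval; ′-cong; isEquivalence)
  open IsRDMH A∈RDMH
  open IsDeMorgan isDeMorgan

  private
    H : HeytingAlgebra c ℓ ℓ
    H = record { isHeytingAlgebra = isHeyting }

    open HeytingAlgebra H
      using ( _≤_; antisym; reflexive; maximum; minimum; module Eq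
            ; x≤x∨y; y≤x∨y; ∨-least; x∧y≤x; x∧y≤y; ∧-greatest
            ; transpose-⇨; transpose-∧)
      renaming (refl to ≤-refl; trans to ≤-trans)

    infixr 5 _⇒ᴴ_

    _⇒ᴴ_ : Carrier → Carrier → Carrier
    x ⇒ᴴ y = x ⇒ x ∧ y

    ⇒-elim : ∀ {w x y} → w ≤ x ⇒ y → w ≤ x → w ≤ y
    ⇒-elim f p = ≤-trans (∧-greatest ≤-refl p) (transpose-∧ f)

    ⇒ᴴ-intro : ∀ {w x y} → w ∧ x ≤ y → w ≤ x ⇒ᴴ y
    ⇒ᴴ-intro p = transpose-⇨ (∧-greatest (x∧y≤y _ _) p)

    ⇒ᴴ-elim : ∀ {w x y} → w ≤ x ⇒ᴴ y → w ≤ x → w ≤ y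
    ⇒ᴴ-elim f p = ≤-trans (⇒-elim f p) (x∧y≤y _ _)

    ≤⇒valid : ∀ {x y} → x ≤ y → x ⇒ᴴ y ≈ 1#
    ≤⇒valid p = antisym (maximum _) (⇒ᴴ-intro (≤-trans (x∧y≤y _ _) p))

    valid⇒≤ : ∀ {x y} → x ⇒ᴴ y ≈ 1# → x ≤ y
    valid⇒≤ p = ⇒ᴴ-elim (≤-trans (maximum _) (reflexive (Eq.sym p))) ≤-refl

    -- A left-nested meet serves as a list of hypotheses with the most recent one on the right; this
    -- and the next two projections pick hypotheses from it.
    left : ∀ {w x y} → w ≤ x → w ∧ y ≤ x
    left = ≤-trans (x∧y≤x _ _)

    last : ∀ {w x} → w ∧ x ≤ x
    last = x∧y≤y _ _

    penultimate : ∀ {w x y} → (w ∧ x) ∧ y ≤ x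
    penultimate = left last

    -- Here `x ≤ y` is itself the equation `x ≈ x ∧ y`, so congruence and De Morgan turn it into
    -- `x ′ ≈ x ′ ∨ y ′`.
    ′-antitone : ∀ {x y} → x ≤ y → y ′ ≤ x ′
    ′-antitone {x} {y} x≤y = ≤-trans (y≤x∨y (x ′) (y ′))
      (reflexive (Eq.sym (Eq.trans (′-cong x≤y) (∧-deMorgan x y))))

  ≈⇒valid-↔ : ∀ {x y} → x ≈ y → (x ⇒ᴴ y) ∧ (y ⇒ᴴ x) ≈ 1#
  ≈⇒valid-↔ x≈y = antisym (maximum _)
    (∧-greatest (reflexive (Eq.sym (≤⇒valid (reflexive x≈y))))
                (reflexive (Eq.sym (≤⇒valid (reflexive (Eq.sym x≈y))))))

  valid-↔⇒≈ : ∀ {x y} → (x ⇒ᴴ y) ∧ (y ⇒ᴴ x) ≈ 1# → x ≈ y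
  valid-↔⇒≈ p = antisym
    (valid⇒≤ (antisym (maximum _) (≤-trans 1≤ (x∧y≤x _ _))))
    (valid⇒≤ (antisym (maximum _) (≤-trans 1≤ (x∧y≤y _ _))))
    where 1≤ = reflexive (Eq.sym p)

  module _ (v : ℕ → Carrier) where

    DHMSH-axiom-valid : ∀ {φ} → DHMSH-Axiom φ → eval v φ ≈ 1#
    DHMSH-axiom-valid (ax1 _ _) = ≤⇒valid (x≤x∨y _ _)
    DHMSH-axiom-valid (ax2 _ _) = ≤⇒valid (y≤x∨y _ _)
    DHMSH-axiom-valid (ax3 _ _ _) = ≤⇒valid (⇒ᴴ-intro (⇒ᴴ-intro
      -- To split on the disjunction, the two implications move to the right of the inequality: each
      -- disjunct lies below their meet `⇒` the value of `γ`.
      (⇒-elim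
        (≤-trans last (∨-least (transpose-⇨ (⇒ᴴ-elim (≤-trans last (x∧y≤x _ _)) (left ≤-refl)))
                               (transpose-⇨ (⇒ᴴ-elim (≤-trans last (x∧y≤y _ _)) (left ≤-refl)))))
        (left ≤-refl))))
    DHMSH-axiom-valid (ax4 _ _) = ≤⇒valid (x∧y≤x _ _)
    DHMSH-axiom-valid (ax5 _ _ _) = ≤⇒valid (⇒ᴴ-intro (⇒ᴴ-intro
      (∧-greatest (⇒ᴴ-elim (left (left ≤-refl)) last) (⇒ᴴ-elim penultimate last))))
    DHMSH-axiom-valid ax6 = Eq.refl
    DHMSH-axiom-valid (ax7 _) = ≤⇒valid (minimum _)
    DHMSH-axiom-valid (ax8 _ _ _) = ≤⇒valid (⇒ᴴ-intro (⇒ᴴ-intro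
      (⇒ᴴ-elim (left (left ≤-refl)) (∧-greatest penultimate last))))
    DHMSH-axiom-valid (ax9 _ _ _) = ≤⇒valid (⇒ᴴ-intro
      (⇒ᴴ-elim (⇒ᴴ-elim (left ≤-refl) (≤-trans last (x∧y≤x _ _))) (≤-trans last (x∧y≤y _ _))))
    DHMSH-axiom-valid (ax10 _ _ _) = ≤⇒valid (⇒ᴴ-intro (⇒ᴴ-intro (transpose-⇨
      (⇒-elim penultimate (⇒ᴴ-elim (left penultimate) last)))))
    DHMSH-axiom-valid (ax11 _ _ _) = ≤⇒valid (⇒ᴴ-intro (⇒ᴴ-intro (transpose-⇨
      (⇒ᴴ-elim (left penultimate) (⇒-elim penultimate last)))))
    DHMSH-axiom-valid ax12 = ≤⇒valid (reflexive (Eq.sym 0′≈1))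
    DHMSH-axiom-valid ax13 = ≤⇒valid (reflexive 1′≈0)
    DHMSH-axiom-valid (ax14 _ _) = ≤⇒valid (reflexive (∧-deMorgan _ _))

    RDMH-axiom-valid : ∀ {φ} → RDMH-Axiom φ → eval v φ ≈ 1#
    RDMH-axiom-valid (dhmsh φ∈DHMSH) = DHMSH-axiom-valid φ∈DHMSH
    RDMH-axiom-valid (ax15 _ _) =
      antisym (maximum _) (transpose-⇨ (≤-trans last (x∧y≤x _ _)))
    RDMH-axiom-valid (ax20 _) = ≈⇒valid-↔ (′-involutive _)
    RDMH-axiom-valid (axM₂ _ _) = ≈⇒valid-↔ (regular _ _)

    -- With the valuation fixed, an implication of value `1#` is an inequality between two elements;
    -- (MP) applies it and (CP) reverses it by `′-antitone`.
    soundness : ∀ {p} {Γ : Pred Formula p} {φ} →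
                (∀ ψ → ψ ∈ Γ → eval v ψ ≈ 1#) → Derivable RDMH-Axiom Γ φ → eval v φ ≈ 1#
    soundness Γ-valid (hyp φ∈Γ) = Γ-valid _ φ∈Γ
    soundness Γ-valid (ax φ∈Ax) = RDMH-axiom-valid φ∈Ax
    soundness Γ-valid (mp d e) = antisym (maximum _)
      (≤-trans (reflexive (Eq.sym (soundness Γ-valid d))) (valid⇒≤ (soundness Γ-valid e)))
    soundness Γ-valid (cp d) = ≤⇒valid (′-antitone (valid⇒≤ (soundness Γ-valid d)))

-- The preorder `⊑` of derivable implications.

module Calculus {p : Level} (Γ : Pred Formula p) where

  infix 4 ⊢_ _⊑_ _≡ᴸ_

  ⊢_ : Formula → Set p
  ⊢ φ = Derivable RDMH-Axiom Γ φ

  _⊑_ _≡ᴸ_ : Formula → Formula → Set p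
  α ⊑ β = ⊢ α →ᴴ β
  α ≡ᴸ β = α ⊑ β × β ⊑ α

  private
    variable
      α β γ δ : Formula

  ⊤-derivable : ⊢ `⊤
  ⊤-derivable = ax (dhmsh ax6)

  ⊑-curry : (α `∧ β) ⊑ γ → α ⊑ (β →ᴴ γ)
  ⊑-curry d = mp d (ax (dhmsh (ax8 _ _ _)))

  ⊑-uncurry : α ⊑ (β →ᴴ γ) → (α `∧ β) ⊑ γ
  ⊑-uncurry d = mp d (ax (dhmsh (ax9 _ _ _)))

  ∧-lowerˡ : (α `∧ β) ⊑ α
  ∧-lowerˡ = ax (dhmsh (ax4 _ _))

  ⊑-∧ : γ ⊑ α → γ ⊑ β → γ ⊑ (α `∧ β)
  ⊑-∧ d e = mp e (mp d (ax (dhmsh (ax5 _ _ _))))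

  weaken : ⊢ β → α ⊑ β
  weaken d = mp d (⊑-curry ∧-lowerˡ)

  -- The derivable `β →ᴴ γ` follows from any `α`, and uncurrying moves `β` to the left; no
  -- transitivity is involved.
  weakenˡ : β ⊑ γ → (α `∧ β) ⊑ γ
  weakenˡ d = ⊑-uncurry (weaken d)

  →-congˡ : α ≡ᴸ β → (α `→ γ) ⊑ (β `→ γ)
  →-congˡ (d , e) = mp e (mp d (ax (dhmsh (ax10 _ _ _))))

  →-congʳ : α ≡ᴸ β → (γ `→ α) ⊑ (γ `→ β)
  -- Axiom (11) replaces its second formula by its first, hence the exchanged order of `d` and `e`.
  →-congʳ (d , e) = mp d (mp e (ax (dhmsh (ax11 _ _ _))))

  -- α →ᴴ ⊤ is α → (α ∧ ⊤), in which α ∧ ⊤ may be replaced by α ∧ α.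
  ⊑-refl : α ⊑ α
  ⊑-refl = mp (weaken ⊤-derivable)
    (→-congʳ (⊑-∧ ∧-lowerˡ ∧-lowerˡ , ⊑-∧ ∧-lowerˡ (weaken ⊤-derivable)))

  ∧-lowerʳ : (α `∧ β) ⊑ β
  ∧-lowerʳ = weakenˡ ⊑-refl

  -- Since `α ⊑ β` unfolds to `α → (α ∧ β)`, it suffices that `α ∧ β` and `α ∧ γ` are equivalent,
  -- which left weakening gives.
  ⊑-respʳ : β ≡ᴸ γ → α ⊑ β → α ⊑ γ
  ⊑-respʳ (d , e) f =
    mp f (→-congʳ (⊑-∧ ∧-lowerˡ (weakenˡ d) , ⊑-∧ ∧-lowerˡ (weakenˡ e)))

  -- In `α → (α ∧ γ)` the formula `α` occurs twice: axiom (10) replaces the antecedent, then axiom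
  -- (11) the consequent.
  ⊑-respˡ : α ≡ᴸ β → α ⊑ γ → β ⊑ γ
  ⊑-respˡ (d , e) f = mp (mp f (→-congˡ (d , e)))
    (→-congʳ ( ⊑-∧ (⊑-respʳ (d , e) ∧-lowerˡ) ∧-lowerʳ
             , ⊑-∧ (⊑-respʳ (e , d) ∧-lowerˡ) ∧-lowerʳ))

  -- α may be replaced by α ∧ β, which lies below γ by left weakening.
  ⊑-trans : α ⊑ β → β ⊑ γ → α ⊑ γ
  ⊑-trans d e = ⊑-respˡ (∧-lowerˡ , ⊑-∧ ⊑-refl d) (weakenˡ e)

  ∧-mono : α ⊑ β → γ ⊑ δ → (α `∧ γ) ⊑ (β `∧ δ)
  ∧-mono d e = ⊑-∧ (⊑-trans ∧-lowerˡ d) (⊑-trans ∧-lowerʳ e)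

  ∧-swap : (α `∧ β) ⊑ (β `∧ α)
  ∧-swap = ⊑-∧ ∧-lowerʳ ∧-lowerˡ

  ∨-upperˡ : α ⊑ (α `∨ β)
  ∨-upperˡ = ax (dhmsh (ax1 _ _))

  ∨-upperʳ : β ⊑ (α `∨ β)
  ∨-upperʳ = ax (dhmsh (ax2 _ _))

  ∨-⊑ : α ⊑ γ → β ⊑ γ → (α `∨ β) ⊑ γ
  ∨-⊑ d e = mp e (mp d (ax (dhmsh (ax3 _ _ _))))

  ∨-mono : α ⊑ β → γ ⊑ δ → (α `∨ γ) ⊑ (β `∨ δ)
  ∨-mono d e = ∨-⊑ (⊑-trans d ∨-upperˡ) (⊑-trans e ∨-upperʳ)

  -- The primitive implication.

  discharge : ⊢ α → (α →ᴴ β) ⊑ β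
  discharge d = ⊑-trans (⊑-∧ ⊑-refl (weaken d)) (⊑-uncurry ⊑-refl)

  -- Under the assumption α, the formulas α and ⊤ are equivalent, so axiom (10)
  -- turns α → β into ⊤ → β, which is equivalent to β.
  →⇒→ᴴ : (α `→ β) ⊑ (α →ᴴ β)
  →⇒→ᴴ {α} {β} = ⊑-curry (⊑-trans ∧-swap (⊑-trans (⊑-uncurry replace) ⊤→β⊑β))
    where
    replace : α ⊑ ((α `→ β) →ᴴ (`⊤ `→ β))
    replace = ⊑-trans (⊑-curry ∧-lowerˡ)
                      (mp (weaken ⊤-derivable) (ax (dhmsh (ax10 α `⊤ β))))

    ⊤→β⊑β : (`⊤ `→ β) ⊑ β
    ⊤→β⊑β = ⊑-trans (→-congʳ (⊑-∧ (weaken ⊤-derivable) ⊑-refl , ∧-lowerʳ))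
                     (discharge ⊤-derivable)

  -- Under the assumption α →ᴴ β, axiom (10) replaces α ∧ β by α in the
  -- instance (β ∧ α) → β of axiom (15).
  →ᴴ⇒→ : (α →ᴴ β) ⊑ (α `→ β)
  →ᴴ⇒→ {α} {β} = ⊑-trans (⊑-curry (⊑-∧ ∧-lowerʳ (⊑-uncurry ⊑-refl)))
    (⊑-trans (mp ∧-lowerˡ (ax (dhmsh (ax10 (α `∧ β) α β))))
             (discharge (mp (ax (ax15 β α)) (→-congˡ (∧-swap , ∧-swap)))))

  →-transpose : (α `∧ β) ⊑ γ → α ⊑ (β `→ γ)
  →-transpose d = ⊑-trans (⊑-curry d) →ᴴ⇒→

  →-untranspose : α ⊑ (β `→ γ) → (α `∧ β) ⊑ γ
  →-untranspose d = ⊑-uncurry (⊑-trans d →⇒→ᴴ)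

  →-mono : β ⊑ α → γ ⊑ δ → (α `→ γ) ⊑ (β `→ δ)
  →-mono d e =
    →-transpose (⊑-trans (∧-mono ⊑-refl d) (⊑-trans (→-untranspose ⊑-refl) e))

  ↔⇒≡ᴸ : ⊢ α ↔ᴴ β → α ≡ᴸ β
  ↔⇒≡ᴸ d = mp d ∧-lowerˡ , mp d ∧-lowerʳ

  -- De Morgan negation.

  ∼-involutive : (`∼ `∼ α) ≡ᴸ α
  ∼-involutive = ↔⇒≡ᴸ (ax (ax20 _))

  -- For the converse half, double negation gives `α ∨ β ⊑ ∼(∼α ∧ ∼β)`; (CP) and another double
  -- negation then yield the claim.
  ∼-distrib-∨ : (`∼ (α `∨ β)) ≡ᴸ (`∼ α `∧ `∼ β)
  ∼-distrib-∨ =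
    ⊑-∧ (cp ∨-upperˡ) (cp ∨-upperʳ) ,
    ⊑-trans (proj₂ ∼-involutive) (cp (⊑-trans (∨-mono (proj₂ ∼-involutive) (proj₂ ∼-involutive))
      (∨-⊑ (cp ∧-lowerˡ) (cp ∧-lowerʳ))))

  ∼-distrib-∧ : (`∼ (α `∧ β)) ≡ᴸ (`∼ α `∨ `∼ β)
  ∼-distrib-∧ = ax (dhmsh (ax14 _ _)) , ∨-⊑ (cp ∧-lowerˡ) (cp ∧-lowerʳ)

-- The Lindenbaum-Tarski algebra.

-- The carrier is lifted to reach an arbitrary level c.
module Lindenbaum (c : Level) {ℓ : Level} (Γ : Pred Formula ℓ) where
  open Calculus Γ

  -- Interderivability from `Γ` is taken as the equality on formulas instead of forming a quotient.
  -- The agreement of `→` with `→ᴴ` enters through `exponential`.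
  heytingAlgebra : HeytingAlgebra c ℓ ℓ
  heytingAlgebra = record
    { Carrier = Lift c Formula
    ; _≈_ = λ x y → lower x ≡ᴸ lower y
    ; _≤_ = λ x y → lower x ⊑ lower y
    ; _∨_ = λ x y → lift (lower x `∨ lower y)
    ; _∧_ = λ x y → lift (lower x `∧ lower y)
    ; _⇨_ = λ x y → lift (lower x `→ lower y)
    ; ⊤ = lift `⊤
    ; ⊥ = lift `⊥
    ; isHeytingAlgebra = record
      { isBoundedLattice = record
        { isLattice = record
          { isPartialOrder = record
            { isPreorder = record
              { isEquivalence = record
                { refl  = ⊑-refl , ⊑-refl
                ; sym   = λ (d , e) → e , d
                ; trans = λ (d , e) (f , g) → ⊑-trans d f , ⊑-trans g e
                }
              ; reflexive = proj₁
              ; trans     = ⊑-trans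
              }
            ; antisym = _,_
            }
          ; supremum = λ _ _ → ∨-upperˡ , ∨-upperʳ , λ _ → ∨-⊑
          ; infimum  = λ _ _ → ∧-lowerˡ , ∧-lowerʳ , λ _ → ⊑-∧
          }
        ; maximum = λ _ → weaken ⊤-derivable
        ; minimum = λ _ → ax (dhmsh (ax7 _))
        }
      ; exponential = λ _ _ _ → →-transpose , →-untranspose
      }
    }

  private
    module H = HeytingAlgebra heytingAlgebra
    module J = BoundedJoin H.boundedJoinSemilattice
    module M = BoundedMeet H.boundedMeetSemilattice
    module D = Distributive (Heyting.distributiveLattice heytingAlgebra)

  algebra : Algebra c ℓ
  algebra = record
    { Carrier       = H.Carrier
    ; _≈_           = H._≈_
    ; _∨_           = H._∨_
    ; _∧_           = H._∧_
    ; _⇒_           = H._⇨_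
    ; _′            = λ x → lift (`∼ lower x)
    ; 0#            = H.⊥
    ; 1#            = H.⊤
    ; isEquivalence = H.isEquivalence
    ; ∨-cong        = Join.∨-cong H.joinSemilattice
    ; ∧-cong        = Meet.∧-cong H.meetSemilattice
    ; ⇒-cong        = Heyting.⇨-cong heytingAlgebra
    -- (CP) applies to everything derivable from `Γ`, so negation respects equivalence relative to
    -- `Γ`.
    ; ′-cong        = λ (d , e) → cp e , cp d
    }

  isRDMH : IsRDMH algebra
  isRDMH = record
    { isHeyting  = naturalIsHeytingAlgebra heytingAlgebra
    ; isDeMorgan = record
      { isDistributiveLattice = record
        { isLattice   = LatticeProperties.isAlgLattice H.lattice
        ; ∨-distrib-∧ = D.∨-distrib-∧
        ; ∧-distrib-∨ = D.∧-distrib-∨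
        }
      ; ∨-identity   = J.identity
      ; ∧-identity   = M.identity
      ; ′-involutive = λ _ → ∼-involutive
      ; ∨-deMorgan   = λ _ _ → ∼-distrib-∨
      ; ∧-deMorgan   = λ _ _ → ∼-distrib-∧
      ; 0′≈1         = weaken ⊤-derivable , ax (dhmsh ax12)
      ; 1′≈0         = ax (dhmsh ax13) , ax (dhmsh (ax7 _))
      }
    ; regular = λ _ _ → ↔⇒≡ᴸ (ax (axM₂ _ _))
    }

  open Algebra algebra using (eval)

  canonical : ℕ → Lift c Formula
  canonical n = lift (var n)

  -- The truth lemma: it reduces validity under the canonical valuation to derivability from `Γ`.
  eval-canonical : ∀ φ → eval canonical φ ≡ lift φ
  eval-canonical (var n)  = refl
  eval-canonical (φ `∨ ψ) = cong₂ H._∨_ (eval-canonical φ) (eval-canonical ψ)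
  eval-canonical (φ `∧ ψ) = cong₂ H._∧_ (eval-canonical φ) (eval-canonical ψ)
  eval-canonical (φ `→ ψ) = cong₂ H._⇨_ (eval-canonical φ) (eval-canonical ψ)
  eval-canonical (`∼ φ)   = cong (λ x → lift (`∼ lower x)) (eval-canonical φ)
  eval-canonical `⊥       = refl
  eval-canonical `⊤       = refl

  derivable⇒≈⊤ : ∀ {φ} → ⊢ φ → eval canonical φ H.≈ H.⊤
  derivable⇒≈⊤ {φ} d rewrite eval-canonical φ = weaken ⊤-derivable , weaken d

  ≈⊤⇒derivable : ∀ {φ} → eval canonical φ H.≈ H.⊤ → ⊢ φ
  ≈⊤⇒derivable {φ} eq rewrite eval-canonical φ = mp ⊤-derivable (proj₂ eq)

-- Algebraizability.

RDMH-equivalentAlgebraicSemantics : (c ℓ : Level) →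
  IsEquivalentAlgebraicSemantics (RDMH-variety c ℓ) (RDMH-logic ℓ)
RDMH-equivalentAlgebraicSemantics c ℓ = record
  { definingEquations   = (var zero `≈ `⊤) ∷ []
  ; equivalenceFormulas = (var zero ↔ᴴ var (suc zero)) ∷ []
  ; conditionA = λ Γ φ → mk⇔
      (λ { d _ (here refl) A A∈RDMH v Γ-valid →
           soundness A∈RDMH v
             (λ ψ ψ∈Γ → Γ-valid _ (_ , ψ , here refl , ψ∈Γ , refl)) d })
      -- Completeness: the algebra is built from this very `Γ`, so the canonical valuation sends
      -- each hypothesis to the top, and therefore `φ` too.
      (λ valid → let open Lindenbaum c Γ in
         ≈⊤⇒derivable (valid _ (here refl) algebra isRDMH canonical
           λ { _ (_ , _ , here refl , ψ∈Γ , refl) → derivable⇒≈⊤ (hyp ψ∈Γ) }))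
  ; conditionB-to = λ { φ ψ _ (_ , _ , here refl , (_ , here refl , refl) , refl) A A∈RDMH v valid →
      ≈⇒valid-↔ A∈RDMH (valid _ refl) }
  ; conditionB-from = λ φ ψ A A∈RDMH v valid →
      valid-↔⇒≈ A∈RDMH
        (valid _ (_ , _ , here refl , (_ , here refl , refl) , refl))
  }

corollary3p14 : (c ℓ : Level) →
    BPAlgebraizable c (RDMH-logic ℓ) ×
    IsEquivalentAlgebraicSemantics (RDMH-variety c ℓ) (RDMH-logic ℓ)
corollary3p14 c ℓ = (RDMH-variety c ℓ , semantics) , semantics
  where semantics = RDMH-equivalentAlgebraicSemantics c ℓ
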